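{- Let $\mathcal{G}=(V,E,\lambda)$ be a happy compressed temporal graph. If $\mathcal{G}$ is two-path-free, then $\mathcal{G}$ is minimal.
   Context: A happy temporal graph is a triple $\mathcal{G}=(V,E,\lambda)$ where $(V,E)$ is a finite simple undirected graph (the footprint) and $\lambda:E\to\{1,2,3,\dots\}$ assigns a single time label to each edge, such that two distinct edges sharing an endpoint have different labels. It is compressed if for every edge $e$ with $\lambda(e)>1$ there is an edge $e'$ adjacent to $e$ with $\lambda(e')=\lambda(e)-1$. A temporal walk is a walk in the footprint along which edge labels are strictly increasing (so no edge is repeated); write $u\leadsto v$ if there is a temporal walk from $u$ to $v$. $\mathcal{G}$ is two-path-free if for all distinct $u,v\in V$ there is at most one temporal walk from $u$ to $v$. The reachability graph $\mathcal{R}(\mathcal{G})$ is the static directed graph on $V$ with arc set $\{(u,v): u\leadsto v\}$. $\mathcal{G}$ is minimal if for every $e\in E$, $\mathcal{R}(\mathcal{G}\setminus\{e\})\neq\mathcal{R}(\mathcal{G})$, where $\mathcal{G}\setminus\{e\}$ is obtained by deleting $e$ and keeping all vertices and all other edges with their labels. -}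

module Defs where

open import Data.Bool.Base using (Bool; T; _∧_; not)
open import Data.Bool.Properties using (T-∧)
open import Data.Fin.Base using (Fin; _<_)
open import Data.Fin.Properties using (_≟_)
open import Data.List.Base using (List; []; _∷_; map)
open import Data.List.Relation.Unary.Linked using (Linked)
open import Data.Nat.Base as ℕ using (ℕ)
open import Data.Product.Base using (Σ; ∃-syntax; _×_; _,_; proj₁)
open import Data.Sum.Base using (_⊎_)
open import Function.Bundles using (Equivalence)
open import Level using (0ℓ)
open import Relation.Binary.Core using (Rel; _⇔_)
open import Relation.Binary.Definitions using (DecidableEquality)
open import Relation.Binary.PropositionalEquality using (_≡_; _≢_; refl; cong)
open import Relation.Nullary using (¬_; yes; no; does)

-- A two-element subset of Fin n, represented by its increasing enumeration.
-- The order proof is irrelevant, so equality is equality of subsets.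
record Pair (n : ℕ) : Set where
  constructor pair
  field
    lo hi  : Fin n
    .lo<hi : lo < hi

open Pair public using (lo; hi)

_≟ₚ_ : ∀ {n} → DecidableEquality (Pair n)
pair a b _ ≟ₚ pair c d _ with a ≟ c | b ≟ d
... | yes refl | yes refl = yes refl
... | yes _    | no b≢d   = no λ eq → b≢d (cong hi eq)
... | no a≢c   | _        = no λ eq → a≢c (cong lo eq)

-- The edge set is a subset of the two-element subsets of the vertex set, so the
-- footprint is simple and undirected by construction.  T b is a proposition,
-- so distinct elements of Edge have distinct underlying pairs.
record TemporalGraph (n : ℕ) : Set where
  field
    isEdge : Pair n → Bool

  Edge : Set
  Edge = Σ (Pair n) λ p → T (isEdge p)

  field
    label   : Edge → ℕ
    label≥1 : ∀ e → 1 ℕ.≤ label e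

  Incident : Fin n → Edge → Set
  Incident v (p , _) = v ≡ lo p ⊎ v ≡ hi p

  Adjacent : Edge → Edge → Set
  Adjacent e f = e ≢ f × ∃[ v ] (Incident v e × Incident v f)

  Joins : Edge → Fin n → Fin n → Set
  Joins (p , _) u v = (lo p ≡ u × hi p ≡ v) ⊎ (lo p ≡ v × hi p ≡ u)

  -- An edge joins u to v in at most one way (lo p ≢ hi p), so propositional
  -- equality of walks is equality of the underlying vertex-edge sequences.
  data Walk : Fin n → Fin n → Set where
    nil  : ∀ {u} → Walk u u
    step : ∀ {u v w} (e : Edge) → Joins e u v → Walk v w → Walk u w

  edges : ∀ {u v} → Walk u v → List Edge
  edges nil          = []
  edges (step e _ p) = e ∷ edges p

  Temporal : ∀ {u v} → Walk u v → Set
  Temporal p = Linked ℕ._<_ (map label (edges p))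

  _⇝_ : Fin n → Fin n → Set
  u ⇝ v = Σ (Walk u v) Temporal

  Happy : Set
  Happy = ∀ e f → Adjacent e f → label e ≢ label f

  Compressed : Set
  Compressed = ∀ e → 1 ℕ.< label e →
               ∃[ f ] (Adjacent e f × label f ≡ label e ℕ.∸ 1)

  TwoPathFree : Set
  TwoPathFree = ∀ u v → u ≢ v → (p q : Walk u v) →
                Temporal p → Temporal q → p ≡ q

open TemporalGraph public using (Edge; Happy; Compressed; TwoPathFree)

-- A digraph on Fin n is given by its arc relation.  Walks of length zero are
-- allowed, so every vertex carries a loop.
ℛ : ∀ {n} → TemporalGraph n → Rel (Fin n) 0ℓ
ℛ G = TemporalGraph._⇝_ G

_∖_ : ∀ {n} (G : TemporalGraph n) → Edge G → TemporalGraph n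
_∖_ {n} G (p , _) = record
  { isEdge  = isEdge′
  ; label   = λ f → G.label (keep f)
  ; label≥1 = λ f → G.label≥1 (keep f)
  }
  where
  module G = TemporalGraph G

  isEdge′ : Pair n → Bool
  isEdge′ q = G.isEdge q ∧ not (does (q ≟ₚ p))

  keep : Σ (Pair n) (λ q → T (isEdge′ q)) → G.Edge
  keep (q , t) = q , proj₁ (Equivalence.to T-∧ t)

-- Two digraphs on the same vertices are equal iff they have the same arcs;
-- _⇔_ is mutual inclusion of relations.
Minimal : ∀ {n} → TemporalGraph n → Set
Minimal G = ∀ (e : Edge G) → ¬ (ℛ (G ∖ e) ⇔ ℛ G)

{-# OPTIONS --safe #-}
-- If deleting e kept the reachability relation, there would be a temporal walk
-- avoiding e between the endpoints of e; in G it competes with the walk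
-- consisting of e alone, and the two differ since only one of them uses e.
module Submission where

open import Defs
open import Data.Bool.Properties using (T-∧; T-not-≡)
open import Data.Fin.Properties using (_≟_; <⇒≢)
open import Data.List.Base using (_∷_; map)
open import Data.List.Relation.Unary.All as All using (All; []; _∷_)
open import Data.List.Relation.Unary.Linked using (Linked; [-])
open import Data.Nat.Base as ℕ using (ℕ)
open import Data.Product.Base using (_,_; proj₁; proj₂)
open import Data.Sum.Base using (inj₁)
open import Function.Bundles using (Equivalence)
open import Relation.Binary.PropositionalEquality
  using (_≡_; _≢_; refl; sym; trans; cong; subst)
open import Relation.Nullary using (contradiction)
open import Relation.Nullary.Decidable using (dec-true; recompute; ¬?)

-- The order proof in a `Pair` is irrelevant, so the inequality derived from it has to be recomputed
-- from decidability of equality on `Fin n`.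
lo≢hi : ∀ {n} (p : Pair n) → lo p ≢ hi p
lo≢hi (pair a b a<b) = recompute (¬? (a ≟ b)) (<⇒≢ a<b)

module Deletion {n : ℕ} (G : TemporalGraph n) (e : Edge G) where

  open TemporalGraph G hiding (Edge; Happy; Compressed; TwoPathFree)
  module G∖e = TemporalGraph (G ∖ e)

  -- Has the same body as the local `keep` of `_∖_`, so the label of `f` in `G ∖ e` is by
  -- computation that of `retained f` in `G`.
  retained : Edge (G ∖ e) → Edge G
  retained (q , t) = q , proj₁ (Equivalence.to T-∧ t)

  retained≢ : ∀ f → retained f ≢ e
  retained≢ (q , t) eq =
    -- The second conjunct of `isEdge′` says that the test `q ≟ₚ proj₁ e` fails, whereas `eq` would
    -- make it succeed.
    contradiction (trans (sym (dec-true (q ≟ₚ proj₁ e) (cong proj₁ eq))) does≡false) λ ()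
    where
    does≡false = Equivalence.to T-not-≡ (proj₂ (Equivalence.to (T-∧ {isEdge q}) t))

  include : ∀ {u v} → G∖e.Walk u v → Walk u v
  include G∖e.nil          = nil
  -- `Joins` looks only at the underlying pair, so `j` carries over unchanged.
  include (G∖e.step f j w) = step (retained f) j (include w)

  include-avoids : ∀ {u v} (w : G∖e.Walk u v) → All (_≢ e) (edges (include w))
  include-avoids G∖e.nil          = []
  include-avoids (G∖e.step f j w) = retained≢ f ∷ include-avoids w

  include-labels : ∀ {u v} (w : G∖e.Walk u v) →
                   map G∖e.label (G∖e.edges w) ≡ map label (edges (include w))
  include-labels G∖e.nil          = refl
  include-labels (G∖e.step f j w) = cong (G∖e.label f ∷_) (include-labels w)

  include-temporal : ∀ {u v} (w : G∖e.Walk u v) → G∖e.Temporal w → Temporal (include w)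
  include-temporal w = subst (Linked ℕ._<_) (include-labels w)

lemma3p10 : (n : ℕ) (G : TemporalGraph n) →
    Happy G → Compressed G → TwoPathFree G → Minimal G
lemma3p10 n G _ _ twoPathFree e@(p , _) (_ , ℛG⊆ℛG∖e) = e≢e refl
  where
  open TemporalGraph G hiding (Edge; Happy; Compressed; TwoPathFree)
  open Deletion G e

  single : Walk (lo p) (hi p)
  single = step e (inj₁ (refl , refl)) nil

  detour : lo p G∖e.⇝ hi p
  detour = ℛG⊆ℛG∖e (single , [-])

  include-detour≡single : include (proj₁ detour) ≡ single
  include-detour≡single = twoPathFree (lo p) (hi p) (lo≢hi p) _ single
    (include-temporal (proj₁ detour) (proj₂ detour)) [-]

  e≢e : e ≢ e
  -- Once the detour is identified with `single`, its avoidance of `e` applies to the only edge of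
  -- `single`, which is `e` itself.
  e≢e = All.head (subst (λ w → All (_≢ e) (edges w)) include-detour≡single
                        (include-avoids (proj₁ detour)))
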